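{- Let $G$ be a connected graph of order $n\ge 2$. Then $G$ is $\mathfrak{d}(G)$-partition dimensional, and the time complexity of computing $\mathfrak{d}(G)$ is $O(n^3)$.
   Context: All graphs $G=(V,E)$ are finite, simple, connected and have at least two vertices; $d(x,y)$ denotes the length of a shortest path between $x$ and $y$ in $G$. For $a\in V$ and nonempty $S\subseteq V$, $d(a,S)=\min_{v\in S} d(a,v)$. A nonempty set $S\subseteq V$ distinguishes two different vertices $x,y\in V$ if $d(x,S)\neq d(y,S)$. For a positive integer $k$, a partition $\Pi$ of $V$ (into nonempty sets) is a $k$-partition generator of $G$ if every pair of different vertices of $G$ is distinguished by at least $k$ of the sets of $\Pi$. A $k$-partition basis of $G$ is a $k$-partition generator of minimum cardinality among all $k$-partition generators of $G$. The graph $G$ is $k$-partition dimensional if $k$ is the largest integer such that there exists a $k$-partition basis of $G$. For different $x,y\in V$, $\mathcal{D}_G(x,y)=\{z\in V: d(z,x)\neq d(z,y)\}$, and $\mathfrak{d}(G)=\min_{x,y\in V,\,x\neq y}|\mathcal{D}_G(x,y)|$. -}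

module Defs where

open import Data.Bool using (Bool; true; false; T; if_then_else_)
open import Data.Bool.Properties using (T?)
open import Data.Fin using (Fin; zero; suc; fromℕ<; remQuot)
import Data.Fin.Properties as Fin
open import Data.Fin.Subset using (Subset; Nonempty; Empty; _∈_; _∩_; ∣_∣)
open import Data.Fin.Subset.Properties using (_∈?_)
open import Data.Nat using (ℕ; zero; suc; _+_; _*_; _∸_; _≤_; _≟_; _<?_; z≤n; s≤s)
open import Data.Product using (∃; ∃₂; _×_; _,_; proj₁; proj₂; uncurry)
open import Data.Vec using (Vec; []; _∷_; head; last; lookup; tabulate)
open import Data.Vec.Relation.Unary.AllPairs using (allPairs?)
open import Data.Vec.Relation.Unary.Linked using (Linked; linked?)
open import Data.Vec.Relation.Unary.Unique.Propositional using (Unique)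
open import Function using (_∘_)
open import Relation.Binary.PropositionalEquality using (_≡_; _≢_; refl)
open import Relation.Nullary using (¬_; Dec; yes; no; does; contradiction)
open import Relation.Nullary.Decidable using (map′; _×-dec_; ¬?)
open import Relation.Unary using (Pred; Decidable)
open import Level using (0ℓ)

private
  variable
    n p : ℕ

IsMinimum : Pred ℕ 0ℓ → Pred ℕ 0ℓ
IsMinimum P m = P m × (∀ k → P k → m ≤ k)

IsMaximum : Pred ℕ 0ℓ → Pred ℕ 0ℓ
IsMaximum P m = P m × (∀ k → P k → k ≤ m)

minimum : {P : Pred ℕ 0ℓ} → Decidable P → ∃ P → ∃ (IsMinimum P)
minimum {P} P? (m , Pm) = search m P? Pm
  where
  search : ∀ m {P : Pred ℕ 0ℓ} → Decidable P → P m → ∃ (IsMinimum P)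
  search zero    P? P0 = 0 , P0 , λ _ _ → z≤n
  search (suc m) P? Pm with P? 0
  ... | yes P0 = 0 , P0 , λ _ _ → z≤n
  ... | no ¬P0 with search m (P? ∘ suc) Pm
  ...   | l , Pl , least = suc l , Pl , λ where
          zero    P0 → contradiction P0 ¬P0
          (suc k) Pk → s≤s (least k Pk)

⟦_⟧ : {P : Pred (Fin n) 0ℓ} → Decidable P → Subset n
⟦ P? ⟧ = tabulate (does ∘ P?)

anyVec? : ∀ {m} {P : Pred (Vec (Fin n) m) 0ℓ} → Decidable P → Dec (∃ P)
anyVec? {m = zero}  P? = map′ ([] ,_) (λ { ([] , p) → p }) (P? [])
anyVec? {m = suc m} P? =
  map′ (λ { (x , xs , p) → x ∷ xs , p }) (λ { (x ∷ xs , p) → x , xs , p })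
       (Fin.any? λ x → anyVec? λ xs → P? (x ∷ xs))

record SimpleGraph (n : ℕ) : Set where
  field
    adj         : Fin n → Fin n → Bool
    symmetric   : ∀ x y → adj x y ≡ adj y x
    irreflexive : ∀ x → adj x x ≡ false

  Adj : Fin n → Fin n → Set
  Adj x y = T (adj x y)

  IsPath : Fin n → Fin n → ∀ {k} → Vec (Fin n) (suc k) → Set
  IsPath x y v = head v ≡ x × last v ≡ y × Linked Adj v × Unique v

  HasPath : Fin n → Fin n → Pred ℕ 0ℓ
  HasPath x y k = ∃ λ (v : Vec (Fin n) (suc k)) → IsPath x y v

  hasPath? : ∀ x y → Decidable (HasPath x y)
  hasPath? x y k = anyVec? λ v →
    (head v Fin.≟ x) ×-dec (last v Fin.≟ y) ×-dec
    linked? (λ a b → T? (adj a b)) v ×-dec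
    allPairs? (λ a b → ¬? (a Fin.≟ b)) v

  Connected : Set
  Connected = ∀ x y → ∃ (HasPath x y)

record Graph (n : ℕ) : Set where
  field
    simpleGraph : SimpleGraph n
    connected   : SimpleGraph.Connected simpleGraph
    2≤order     : 2 ≤ n

  open SimpleGraph simpleGraph public

module _ (G : Graph n) where
  open Graph G

  d-min : ∀ x y → ∃ (IsMinimum (HasPath x y))
  d-min x y = minimum (hasPath? x y) (connected x y)

  d : Fin n → Fin n → ℕ
  d x y = proj₁ (d-min x y)

  dSet-min : ∀ a (S : Subset n) → Nonempty S →
             ∃ (IsMinimum λ k → ∃ λ v → v ∈ S × d a v ≡ k)
  dSet-min a S (v , v∈S) =
    minimum (λ k → Fin.any? λ v → (v ∈? S) ×-dec (d a v ≟ k))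
            (d a v , v , v∈S , refl)

  dSet : Fin n → (S : Subset n) → Nonempty S → ℕ
  dSet a S S≢∅ = proj₁ (dSet-min a S S≢∅)

  Distinguishes : (S : Subset n) → Nonempty S → Fin n → Fin n → Set
  Distinguishes S S≢∅ x y = dSet x S S≢∅ ≢ dSet y S S≢∅

  distinguishes? : ∀ S S≢∅ x y → Dec (Distinguishes S S≢∅ x y)
  distinguishes? S S≢∅ x y = ¬? (dSet x S S≢∅ ≟ dSet y S S≢∅)

  𝓓 : Fin n → Fin n → Subset n
  𝓓 x y = ⟦ (λ z → ¬? (d z x ≟ d z y)) ⟧

  𝔡-min : ∃ (IsMinimum λ k → ∃₂ λ x y → x ≢ y × ∣ 𝓓 x y ∣ ≡ k)
  𝔡-min = minimum
    (λ k → Fin.any? λ x → Fin.any? λ y → ¬? (x Fin.≟ y) ×-dec (∣ 𝓓 x y ∣ ≟ k))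
    (twoVertices 2≤order)
    where
    twoVertices : 2 ≤ n → ∃ λ k → ∃₂ λ x y → x ≢ y × ∣ 𝓓 x y ∣ ≡ k
    twoVertices (s≤s (s≤s _)) =
      _ , zero , suc zero , (λ ()) , refl

  𝔡 : ℕ
  𝔡 = proj₁ 𝔡-min

record Partition (n p : ℕ) : Set where
  field
    parts    : Vec (Subset n) p
    nonempty : ∀ i → Nonempty (lookup parts i)
    disjoint : ∀ i j → i ≢ j → Empty (lookup parts i ∩ lookup parts j)
    covers   : ∀ v → ∃ λ i → v ∈ lookup parts i

module _ (G : Graph n) where

  distinguishing : Partition n p → Fin n → Fin n → Subset p
  distinguishing Π x y = ⟦ (λ i → distinguishes? G (lookup parts i) (nonempty i) x y) ⟧
    where open Partition Π

  IsGenerator : ℕ → Partition n p → Set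
  IsGenerator k Π = ∀ x y → x ≢ y → k ≤ ∣ distinguishing Π x y ∣

  IsBasis : ℕ → Partition n p → Set
  IsBasis {p} k Π =
    IsGenerator k Π × (∀ {q} (Π′ : Partition n q) → IsGenerator k Π′ → p ≤ q)

  IsPartitionDimensional : ℕ → Set
  IsPartitionDimensional =
    IsMaximum λ k → 1 ≤ k × ∃₂ λ p (Π : Partition n p) → IsBasis k Π

-- Running time is measured on a unit-cost random access machine over ℕ, with
-- structured control flow.  Each operation in an expression and each command
-- costs one step.  Addition and truncated subtraction are the only arithmetic:
-- unit-cost multiplication would let t steps build numbers of 2^t bits.

data Expr : Set where
  lit     : ℕ → Expr
  reg     : ℕ → Expr
  mem     : Expr → Expr
  _⊕_ _⊖_ : Expr → Expr → Expr

infixl 6 _⊕_ _⊖_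
infix  4 _≔_ mem[_]≔_
infixr 3 _⨟_

data Command : Set where
  skip     : Command
  _≔_      : ℕ → Expr → Command
  mem[_]≔_ : Expr → Expr → Command
  _⨟_      : Command → Command → Command
  ifNZ_then_else_ : Expr → Command → Command → Command
  whileNZ_loop_   : Expr → Command → Command

record State : Set where
  constructor state
  field
    regs   : ℕ → ℕ
    memory : ℕ → ℕ

open State public

_[_↦_] : (ℕ → ℕ) → ℕ → ℕ → (ℕ → ℕ)
(f [ a ↦ v ]) b = if does (b ≟ a) then v else f b

eval : Expr → State → ℕ
eval (lit k)   σ = k
eval (reg r)   σ = regs σ r
eval (mem e)   σ = memory σ (eval e σ)
eval (e₁ ⊕ e₂) σ = eval e₁ σ + eval e₂ σ
eval (e₁ ⊖ e₂) σ = eval e₁ σ ∸ eval e₂ σ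

cost : Expr → ℕ
cost (lit k)   = 1
cost (reg r)   = 1
cost (mem e)   = suc (cost e)
cost (e₁ ⊕ e₂) = suc (cost e₁ + cost e₂)
cost (e₁ ⊖ e₂) = suc (cost e₁ + cost e₂)

infix 2 ⟨_,_⟩⇓⟨_,_⟩

data ⟨_,_⟩⇓⟨_,_⟩ : Command → State → State → ℕ → Set where
  skip : ∀ {σ} → ⟨ skip , σ ⟩⇓⟨ σ , 1 ⟩

  assign : ∀ {r e σ} →
    ⟨ r ≔ e , σ ⟩⇓⟨ state (regs σ [ r ↦ eval e σ ]) (memory σ) , suc (cost e) ⟩

  store : ∀ {a e σ} →
    ⟨ mem[ a ]≔ e , σ ⟩⇓⟨ state (regs σ) (memory σ [ eval a σ ↦ eval e σ ])
                        , suc (cost a + cost e) ⟩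

  seq : ∀ {c₁ c₂ σ σ′ σ″ t₁ t₂} →
    ⟨ c₁ , σ ⟩⇓⟨ σ′ , t₁ ⟩ → ⟨ c₂ , σ′ ⟩⇓⟨ σ″ , t₂ ⟩ →
    ⟨ c₁ ⨟ c₂ , σ ⟩⇓⟨ σ″ , suc (t₁ + t₂) ⟩

  ifTrue : ∀ {e c₁ c₂ σ σ′ t} → eval e σ ≢ 0 →
    ⟨ c₁ , σ ⟩⇓⟨ σ′ , t ⟩ →
    ⟨ ifNZ e then c₁ else c₂ , σ ⟩⇓⟨ σ′ , suc (cost e + t) ⟩

  ifFalse : ∀ {e c₁ c₂ σ σ′ t} → eval e σ ≡ 0 →
    ⟨ c₂ , σ ⟩⇓⟨ σ′ , t ⟩ →
    ⟨ ifNZ e then c₁ else c₂ , σ ⟩⇓⟨ σ′ , suc (cost e + t) ⟩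

  whileTrue : ∀ {e c σ σ′ σ″ t₁ t₂} → eval e σ ≢ 0 →
    ⟨ c , σ ⟩⇓⟨ σ′ , t₁ ⟩ → ⟨ whileNZ e loop c , σ′ ⟩⇓⟨ σ″ , t₂ ⟩ →
    ⟨ whileNZ e loop c , σ ⟩⇓⟨ σ″ , suc (cost e + t₁ + t₂) ⟩

  whileFalse : ∀ {e c σ} → eval e σ ≡ 0 →
    ⟨ whileNZ e loop c , σ ⟩⇓⟨ σ , suc (cost e) ⟩

-- A graph is presented by its adjacency matrix, stored row by row from address 0
-- (entry (i , j) at address i * n + j), with n in register 0.
adjacencyMemory : Graph n → ℕ → ℕ
adjacencyMemory {n} G a with a <? n * n
... | yes a<n² = if uncurry (Graph.adj G) (remQuot n (fromℕ< a<n²)) then 1 else 0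
... | no  _    = 0

input : Graph n → State
input {n} G = state ((λ _ → 0) [ 0 ↦ n ]) (adjacencyMemory G)

output : State → ℕ
output σ = regs σ 0

_∈O_ : (ℕ → ℕ) → (ℕ → ℕ) → Set
f ∈O g = ∃₂ λ C n₀ → ∀ n → n₀ ≤ n → f n ≤ C * g n

ComputesInTime : Command → (∀ {n} → Graph n → ℕ) → (ℕ → ℕ) → Set
ComputesInTime c F time = ∀ {n} (G : Graph n) →
  ∃₂ λ σ t → ⟨ c , input G ⟩⇓⟨ σ , t ⟩ × output σ ≡ F G × t ≤ time n

HasTimeComplexityO : (∀ {n} → Graph n → ℕ) → (ℕ → ℕ) → Set
HasTimeComplexityO F g = ∃₂ λ c time → ComputesInTime c F time × time ∈O g

{-# OPTIONS --safe #-}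

-- For the dimension: a part distinguishing x and y must contain a vertex of
-- 𝓓 G x y, and distinct parts contain distinct vertices, so no partition is a
-- k-generator for k > 𝔡 G; the partition into singletons attains 𝔡 G.
--
-- For the complexity: the adjacency matrix is turned in place into the distance
-- matrix by the Floyd–Warshall algorithm, and then 𝓓 G x y is counted for every
-- pair x ≢ y.  Correctness of Floyd–Warshall needs no analysis of paths: after
-- relaxing through the vertices below k, the matrix D satisfies the triangle
-- inequality D i j ≤ D i v + D v j for all v < k, and d is the greatest matrix
-- with D i i = 0 and D i j ≤ 1 on edges satisfying all triangle inequalities.

module Submission where

open import Defs
open import Data.Bool using (true; false; T; if_then_else_)
open import Data.Fin using (Fin; zero; suc; toℕ; fromℕ<; combine; remQuot)
import Data.Fin.Properties as Fin
open import Data.Fin.Subset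
  using (Subset; Side; inside; outside; Nonempty; _∈_; _∩_; _-_; ⁅_⁆; ∣_∣)
open import Data.Fin.Subset.Properties
  using (_∈?_; nonempty?; anySubset?; x∈⁅x⁆; x∈⁅y⁆⇒x≡y; x∈p∩q⁺; x∈p∩q⁻; p⊆q⇒∣p∣≤∣q∣;
         x∈p∧x≢y⇒x∈p-y; x∈p⇒∣p-x∣<∣p∣; ∣p∣≤n)
open import Data.Nat
  using (ℕ; zero; suc; _+_; _*_; _∸_; _⊓_; _⊔_; _^_; _≤_; _<_; _≤?_; _<?_; _≟_; z≤n; s≤s; NonZero)
open import Data.Nat.Properties
open import Data.Product using (∃; ∃₂; _×_; _,_; proj₁; proj₂; uncurry)
open import Data.Sum using (_⊎_; inj₁; inj₂)
open import Data.Vec using (Vec; []; _∷_; here; there; last; lookup; tabulate)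
open import Data.Vec.Properties using (lookup∘tabulate; lookup⇒[]=; []=⇒lookup)
open import Data.Vec.Relation.Unary.All using (All; []; _∷_)
open import Data.Vec.Relation.Unary.AllPairs using ([]; _∷_)
open import Data.Vec.Relation.Unary.Linked using (Linked; [-]; _∷_)
open import Data.Vec.Relation.Unary.Unique.Propositional using (Unique)
open import Data.Vec.Relation.Unary.Unique.Propositional.Properties using (lookup-injective)
open import Algebra.Properties.CommutativeSemigroup +-commutativeSemigroup using (x∙yz≈y∙xz)
open import Function using (_∘_; id)
open import Level using (0ℓ)
open import Relation.Binary.PropositionalEquality
  using (_≡_; _≢_; refl; sym; trans; cong; cong₂; subst)
open import Relation.Nullary using (Dec; yes; no; does; contradiction; ¬_)
open import Relation.Nullary.Decidable
  using (map′; _×-dec_; _→-dec_; ¬?; dec-true; dec-false; decidable-stable)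
open import Relation.Unary using (Pred; Decidable)

private
  variable
    m n p : ℕ

-- Finite subsets, exhaustive search and minima.

∈⟦⟧⁺ : {P : Pred (Fin n) 0ℓ} (P? : Decidable P) → ∀ {i} → P i → i ∈ ⟦ P? ⟧
∈⟦⟧⁺ P? {i} Pi =
  lookup⇒[]= i ⟦ P? ⟧ (trans (lookup∘tabulate (does ∘ P?) i) (dec-true (P? i) Pi))

∈⟦⟧⁻ : {P : Pred (Fin n) 0ℓ} (P? : Decidable P) → ∀ {i} → i ∈ ⟦ P? ⟧ → P i
∈⟦⟧⁻ P? {i} i∈ with P? i | trans (sym (lookup∘tabulate (does ∘ P?) i)) ([]=⇒lookup i∈)
... | yes Pi | _  = Pi
... | no  _  | ()

-- Induction on `p`: an element at the head uses up its image, and injectivity keeps the remaining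
-- images inside `q - f here`. The map may depend on the membership proof, because `pick` below
-- extracts its vertex from such a proof.
injection⇒∣p∣≤∣q∣ : (p : Subset m) (q : Subset n) (f : ∀ {i} → i ∈ p → Fin n) →
  (∀ {i} (i∈p : i ∈ p) → f i∈p ∈ q) →
  (∀ {i j} (i∈p : i ∈ p) (j∈p : j ∈ p) → f i∈p ≡ f j∈p → i ≡ j) →
  ∣ p ∣ ≤ ∣ q ∣
injection⇒∣p∣≤∣q∣ []            q f f∈q inj = z≤n
injection⇒∣p∣≤∣q∣ (outside ∷ p) q f f∈q inj =
  injection⇒∣p∣≤∣q∣ p q (f ∘ there) (f∈q ∘ there)
    λ i∈p j∈p → Fin.suc-injective ∘ inj (there i∈p) (there j∈p)
injection⇒∣p∣≤∣q∣ (inside ∷ p) q f f∈q inj = ≤-trans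
  (s≤s (injection⇒∣p∣≤∣q∣ p (q - f here) (f ∘ there)
    (λ i∈p → x∈p∧x≢y⇒x∈p-y (f∈q (there i∈p))
      λ eq → contradiction (inj (there i∈p) here eq) λ ())
    λ i∈p j∈p → Fin.suc-injective ∘ inj (there i∈p) (there j∈p)))
  (x∈p⇒∣p-x∣<∣p∣ (f∈q here))

anySubsets? : {P : Pred (Vec (Subset n) p) 0ℓ} → Decidable P → Dec (∃ P)
anySubsets? {p = zero}  P? = map′ ([] ,_) (λ { ([] , Pv) → Pv }) (P? [])
anySubsets? {p = suc p} P? =
  map′ (λ { (S , v , Pv) → S ∷ v , Pv }) (λ { (S ∷ v , Pv) → S , v , Pv })
       (anySubset? λ S → anySubsets? λ v → P? (S ∷ v))

minimum-unique : ∀ {P : Pred ℕ 0ℓ} {k l} → IsMinimum P k → IsMinimum P l → k ≡ l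
minimum-unique (Pk , k≤) (Pl , l≤) = ≤-antisym (k≤ _ Pl) (l≤ _ Pk)

-- Paths and the distance in a graph.

module _ (G : Graph n) where
  open Graph G

  d-path : ∀ x y → HasPath x y (d G x y)
  d-path x y = proj₁ (proj₂ (d-min G x y))

  d≤ : ∀ {x y k} → HasPath x y k → d G x y ≤ k
  d≤ {x} {y} = proj₂ (proj₂ (d-min G x y)) _

  d-refl : ∀ x → d G x x ≡ 0
  d-refl x = n≤0⇒n≡0 (d≤ (x ∷ [] , refl , refl , [-] , [] ∷ []))

  d≡0⇒≡ : ∀ {x y} → d G x y ≡ 0 → x ≡ y
  d≡0⇒≡ {x} {y} d≡0 = ends (subst (HasPath x y) d≡0 (d-path x y))
    where
    ends : HasPath x y 0 → x ≡ y
    ends (_ ∷ [] , refl , refl , _) = refl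

  -- A path with `d G x y` edges has one more vertex than edges, and its pairwise different vertices
  -- inject into `Fin n`.
  d<n : ∀ x y → d G x y < n
  d<n x y = let _ , _ , _ , _ , unique = d-path x y in
    Fin.injective⇒≤ (lookup-injective unique _ _)

  -- Paths may not repeat vertices, so `x` can be put in front of a path only if it is not yet on
  -- it. Otherwise the suffix starting at `x` is already a path to the same end.
  avoid-or-cut : ∀ x {k} (v : Vec (Fin n) (suc k)) → Linked Adj v → Unique v →
                 All (x ≢_) v ⊎ ∃ λ l → l ≤ k × HasPath x (last v) l
  avoid-or-cut x (w ∷ v) L U with x Fin.≟ w
  avoid-or-cut x (w ∷ v)      L U | yes refl = inj₂ (_ , ≤-refl , w ∷ v , refl , refl , L , U)
  avoid-or-cut x (w ∷ [])     L U | no x≢w   = inj₁ (x≢w ∷ [])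
  avoid-or-cut x (w ∷ v@(_ ∷ _)) (_ ∷ L) (_ ∷ U) | no x≢w with avoid-or-cut x v L U
  ... | inj₁ x∉v            = inj₁ (x≢w ∷ x∉v)
  ... | inj₂ (l , l≤k , xv) = inj₂ (l , m≤n⇒m≤1+n l≤k , xv)

  d-step : ∀ {x w} y → Adj x w → d G x y ≤ suc (d G w y)
  d-step {x} {w} y xw = extend (d-path w y)
    where
    extend : ∀ {k} → HasPath w y k → d G x y ≤ suc k
    extend (v@(_ ∷ _) , refl , refl , L , U) with avoid-or-cut x v L U
    ... | inj₁ x∉v            = d≤ (x ∷ v , refl , refl , xw ∷ L , x∉v ∷ U)
    ... | inj₂ (l , l≤k , xy) = ≤-trans (d≤ xy) (m≤n⇒m≤1+n l≤k)

  -- Concatenating two paths may repeat vertices; instead a shortest path from `x` to `z` is walked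
  -- edge by edge, with `d-step` at each edge.
  d-triangle : ∀ x z y → d G x y ≤ d G x z + d G z y
  d-triangle x z y = along (d-path x z)
    where
    along : ∀ {x k} → HasPath x z k → d G x y ≤ k + d G z y
    along (_ ∷ []        , refl , refl , _)                    = ≤-refl
    along (x ∷ v@(w ∷ _) , refl , refl , xw ∷ L , _ ∷ U) =
      ≤-trans (d-step y xw) (s≤s (along (v , refl , refl , L , U)))

  Adj-sym : ∀ {x y} → Adj x y → Adj y x
  Adj-sym {x} {y} = subst T (symmetric x y)

  Adj⇒d≤1 : ∀ {x y} → Adj x y → d G x y ≤ 1
  Adj⇒d≤1 {x} {y} xy = subst (λ k → d G x y ≤ suc k) (d-refl y) (d-step y xy)

  -- Along a shortest path the triangle inequalities add up, and each edge contributes at most 1.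
  d-greatest : (D : Fin n → Fin n → ℕ) → (∀ x → D x x ≤ 0) →
    (∀ {x y} → Adj x y → D x y ≤ 1) → (∀ x z y → D x y ≤ D x z + D z y) →
    ∀ x y → D x y ≤ d G x y
  d-greatest D D-refl D-adj D-triangle x y = along (d-path x y)
    where
    along : ∀ {x k} → HasPath x y k → D x y ≤ k
    along (x ∷ []        , refl , refl , _)                    = D-refl x
    along (x ∷ v@(w ∷ _) , refl , refl , xw ∷ L , _ ∷ U) =
      ≤-trans (D-triangle x w y) (+-mono-≤ (D-adj xw) (along (v , refl , refl , L , U)))

  -- The transpose of `d` satisfies the hypotheses of `d-greatest`, so no path has to be reversed.
  d-sym : ∀ x y → d G x y ≡ d G y x
  d-sym x y = ≤-antisym (d-sym-≤ y x) (d-sym-≤ x y)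
    where
    d-sym-≤ : ∀ x y → d G y x ≤ d G x y
    d-sym-≤ = d-greatest (λ x y → d G y x) (≤-reflexive ∘ d-refl) (Adj⇒d≤1 ∘ Adj-sym)
      λ x z y → ≤-trans (d-triangle y z x) (≤-reflexive (+-comm (d G y z) (d G z x)))

  -- Distances to sets, and the minimum `𝔡`.

  dSet-isMinimum : ∀ x {S} (S≢∅ : Nonempty S) →
                   IsMinimum (λ k → ∃ λ v → v ∈ S × d G x v ≡ k) (dSet G x S S≢∅)
  dSet-isMinimum x {S} S≢∅ = proj₂ (dSet-min G x S S≢∅)

  dSet-irrelevant : ∀ x {S} (p q : Nonempty S) → dSet G x S p ≡ dSet G x S q
  dSet-irrelevant x p q = minimum-unique (dSet-isMinimum x p) (dSet-isMinimum x q)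

  dSet-cong : ∀ {x y S} (S≢∅ : Nonempty S) → (∀ v → v ∈ S → d G x v ≡ d G y v) →
              dSet G x S S≢∅ ≡ dSet G y S S≢∅
  dSet-cong {x} {y} S≢∅ eq = let (v , v∈S , xv) , least = dSet-isMinimum x S≢∅ in
    minimum-unique
    ((v , v∈S , trans (sym (eq v v∈S)) xv) ,
     λ { k (w , w∈S , yw) → least k (w , w∈S , trans (eq w w∈S) yw) })
    (dSet-isMinimum y S≢∅)

  dSet-⁅⁆ : ∀ x z (S≢∅ : Nonempty ⁅ z ⁆) → dSet G x ⁅ z ⁆ S≢∅ ≡ d G x z
  dSet-⁅⁆ x z S≢∅ = let (v , v∈S , xv) , _ = dSet-isMinimum x S≢∅ in
    trans (sym xv) (cong (d G x) (x∈⁅y⁆⇒x≡y z v∈S))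

  𝔡-isMinimum : IsMinimum (λ k → ∃₂ λ x y → x ≢ y × ∣ 𝓓 G x y ∣ ≡ k) (𝔡 G)
  𝔡-isMinimum = proj₂ (𝔡-min G)

  𝔡≤∣𝓓∣ : ∀ {x y} → x ≢ y → 𝔡 G ≤ ∣ 𝓓 G x y ∣
  𝔡≤∣𝓓∣ {x} {y} x≢y = proj₂ 𝔡-isMinimum _ (x , y , x≢y , refl)

  x∈𝓓xy : ∀ {x y} → x ≢ y → x ∈ 𝓓 G x y
  x∈𝓓xy {x} {y} x≢y = ∈⟦⟧⁺ (λ z → ¬? (d G z x ≟ d G z y))
    λ eq → x≢y (d≡0⇒≡ (trans (sym eq) (d-refl x)))

  1≤𝔡 : 1 ≤ 𝔡 G
  1≤𝔡 = let (x , y , x≢y , ∣𝓓∣≡𝔡) , _ = 𝔡-isMinimum in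
    subst (1 ≤_) ∣𝓓∣≡𝔡 (≤-trans (s≤s z≤n) (x∈p⇒∣p-x∣<∣p∣ (x∈𝓓xy x≢y)))

  -- Distinguishing parts against `𝓓`: the upper bound and the singletons.

  ∣distinguishing∣≤∣𝓓∣ : (Π : Partition n p) → ∀ x y →
                         ∣ distinguishing G Π x y ∣ ≤ ∣ 𝓓 G x y ∣
  ∣distinguishing∣≤∣𝓓∣ Π x y =
    injection⇒∣p∣≤∣q∣ _ _ (proj₁ ∘ pick) (proj₂ ∘ proj₂ ∘ pick)
      λ {i} {j} i∈ j∈ eq → decidable-stable (i Fin.≟ j) λ i≢j →
        disjoint i j i≢j (_ , x∈p∩q⁺ (proj₁ (proj₂ (pick i∈)) ,
          subst (_∈ lookup parts j) (sym eq) (proj₁ (proj₂ (pick j∈)))))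
    where
    open Partition Π

    pick : ∀ {i} → i ∈ distinguishing G Π x y → ∃ λ v → v ∈ lookup parts i × v ∈ 𝓓 G x y
    pick {i} i∈ with nonempty? (lookup parts i ∩ 𝓓 G x y)
    ... | yes (v , v∈) = v , x∈p∩q⁻ _ _ v∈
    -- If the part misses `𝓓 G x y`, then `x` and `y` are equally far from each of its vertices,
    -- hence from the part.
    ... | no  empty    = contradiction
      (dSet-cong (nonempty i) λ v v∈ → decidable-stable (d G x v ≟ d G y v) λ ≢ →
        empty (v , x∈p∩q⁺ (v∈ , ∈⟦⟧⁺ (λ z → ¬? (d G z x ≟ d G z y))
          λ eq → ≢ (trans (d-sym x v) (trans eq (d-sym v y))))))
      (∈⟦⟧⁻ (λ i → distinguishes? G (lookup parts i) (nonempty i) x y) i∈)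

  singletons : Partition n n
  singletons = record
    { parts    = tabulate ⁅_⁆
    ; nonempty = λ i → i , subst (i ∈_) (sym (part i)) (x∈⁅x⁆ i)
    ; disjoint = λ { i j i≢j (v , v∈) → let v∈i , v∈j = x∈p∩q⁻ _ _ v∈ in
        i≢j (trans (sym (x∈⁅y⁆⇒x≡y i (subst (v ∈_) (part i) v∈i)))
                   (x∈⁅y⁆⇒x≡y j (subst (v ∈_) (part j) v∈j))) }
    ; covers   = λ v → v , subst (v ∈_) (sym (part v)) (x∈⁅x⁆ v)
    }
    where
    part : ∀ i → lookup (tabulate ⁅_⁆) i ≡ ⁅ i ⁆
    part = lookup∘tabulate ⁅_⁆

  -- The distance to a one-vertex part is the distance to its vertex, so every `z` in `𝓓 G x y`
  -- gives a distinguishing part.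
  singletons-isGenerator : IsGenerator G (𝔡 G) singletons
  singletons-isGenerator x y x≢y = ≤-trans (𝔡≤∣𝓓∣ x≢y) (p⊆q⇒∣p∣≤∣q∣ λ {z} z∈ →
    ∈⟦⟧⁺ (λ i → distinguishes? G (lookup parts i) (nonempty i) x y) λ eq →
      ∈⟦⟧⁻ (λ z → ¬? (d G z x ≟ d G z y)) z∈
        (trans (d-sym z x) (trans (sym (dSet-part x z (nonempty z)))
          (trans eq (trans (dSet-part y z (nonempty z)) (d-sym y z))))))
    where
    open Partition singletons

    dSet-part : ∀ x z (S≢∅ : Nonempty (lookup parts z)) →
                dSet G x (lookup parts z) S≢∅ ≡ d G x z
    dSet-part x z rewrite lookup∘tabulate ⁅_⁆ z = dSet-⁅⁆ x z

  -- Partitions with equal `parts` may carry different proofs of nonemptiness. `dSet` takes such a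
  -- proof as an argument, but the minimum it returns is the same for all of them.
  isGenerator-parts : ∀ {k} (Π Π′ : Partition n p) → Partition.parts Π ≡ Partition.parts Π′ →
                      IsGenerator G k Π → IsGenerator G k Π′
  isGenerator-parts Π Π′ refl gen x y x≢y = ≤-trans (gen x y x≢y) (p⊆q⇒∣p∣≤∣q∣ λ {i} i∈ →
    ∈⟦⟧⁺ (λ i → distinguishes? G (lookup parts i) (nonempty′ i) x y) λ eq →
      ∈⟦⟧⁻ (λ i → distinguishes? G (lookup parts i) (nonempty i) x y) i∈
        (trans (dSet-irrelevant x (nonempty i) (nonempty′ i))
          (trans eq (dSet-irrelevant y (nonempty′ i) (nonempty i)))))
    where
    open Partition Π
    nonempty′ = Partition.nonempty Π′

  isGenerator? : ∀ k (Π : Partition n p) → Dec (IsGenerator G k Π)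
  isGenerator? k Π = Fin.all? λ x → Fin.all? λ y →
    ¬? (x Fin.≟ y) →-dec (k ≤? ∣ distinguishing G Π x y ∣)

-- Search for a generator with the fewest parts.

partition? : (v : Vec (Subset n) p) → Dec (∃ λ Π → Partition.parts Π ≡ v)
partition? {n = n} {p = p} v = map′ make unmake
  ((Fin.all? λ i → nonempty? (lookup v i)) ×-dec
   (Fin.all? λ i → Fin.all? λ j →
     ¬? (i Fin.≟ j) →-dec ¬? (nonempty? (lookup v i ∩ lookup v j))) ×-dec
   (Fin.all? λ x → Fin.any? λ i → x ∈? lookup v i))
  where
  Conditions : Set
  Conditions = (∀ i → Nonempty (lookup v i)) ×
               (∀ i j → i ≢ j → ¬ Nonempty (lookup v i ∩ lookup v j)) ×
               (∀ x → ∃ λ i → x ∈ lookup v i)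

  make : Conditions → ∃ λ Π → Partition.parts Π ≡ v
  make (ne , dj , cv) =
    record { parts = v ; nonempty = ne ; disjoint = dj ; covers = cv } , refl

  unmake : (∃ λ Π → Partition.parts Π ≡ v) → Conditions
  unmake (Π , refl) = nonempty , disjoint , covers where open Partition Π

-- Decidability is what lets `minimum` produce a basis. One partition is tested for each vector of
-- subsets, and `isGenerator-parts` transfers the verdict to all partitions with these parts.
hasGenerator? : (G : Graph n) → ∀ k p → Dec (∃ λ (Π : Partition n p) → IsGenerator G k Π)
hasGenerator? G k p = map′ (λ { (_ , Π , _ , gen) → Π , gen })
  (λ { (Π , gen) → _ , Π , refl , gen }) (anySubsets? generates?)
  where
  generates? : ∀ v → Dec (∃ λ Π → Partition.parts Π ≡ v × IsGenerator G k Π)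
  generates? v with partition? v
  ... | no ¬Π = no λ { (Π , eq , _) → ¬Π (Π , eq) }
  ... | yes (Π , refl) = map′ (λ gen → Π , refl , gen)
    (λ { (Π′ , eq , gen) → isGenerator-parts G Π′ Π eq gen }) (isGenerator? G k Π)

𝔡-partitionDimensional : (G : Graph n) → IsPartitionDimensional G (𝔡 G)
𝔡-partitionDimensional {n} G = (1≤𝔡 G , basis) , maximal
  where
  basis : ∃₂ λ p (Π : Partition n p) → IsBasis G (𝔡 G) Π
  -- The singletons show that the search over the number of parts succeeds.
  basis = let p , (Π , gen) , least = minimum (hasGenerator? G (𝔡 G))
                                        (n , singletons G , singletons-isGenerator G)
          in p , Π , gen , λ Π′ gen′ → least _ (Π′ , gen′)

  maximal : ∀ k → 1 ≤ k × (∃₂ λ p (Π : Partition n p) → IsBasis G k Π) → k ≤ 𝔡 G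
  maximal k (_ , p , Π , gen , _) = let (x , y , x≢y , ∣𝓓∣≡𝔡) , _ = 𝔡-isMinimum G in
    subst (k ≤_) ∣𝓓∣≡𝔡 (≤-trans (gen x y x≢y) (∣distinguishing∣≤∣𝓓∣ G Π x y))

-- Cost and total correctness of programs

-- Bounds the number of steps of a run in which every loop makes at most n iterations.
time : Command → ℕ → ℕ
time skip                        n = 1
time (r ≔ e)                     n = suc (cost e)
time (mem[ a ]≔ e)               n = suc (cost a + cost e)
time (c₁ ⨟ c₂)                   n = suc (time c₁ n + time c₂ n)
time (ifNZ e then c₁ else c₂)    n = suc (cost e + (time c₁ n + time c₂ n))
time (whileNZ e loop c)          n = suc (cost e) + n * suc (cost e + time c n)

loopDepth : Command → ℕ
loopDepth skip                     = 0
loopDepth (r ≔ e)                  = 0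
loopDepth (mem[ a ]≔ e)            = 0
loopDepth (c₁ ⨟ c₂)                = loopDepth c₁ ⊔ loopDepth c₂
loopDepth (ifNZ e then c₁ else c₂) = loopDepth c₁ ⊔ loopDepth c₂
loopDepth (whileNZ e loop c)       = suc (loopDepth c)

module _ (n : ℕ) .{{_ : NonZero n}} where

  const≤*n^ : ∀ c k → c ≤ c * n ^ k
  const≤*n^ c k = m≤m*n c (n ^ k) {{m^n≢0 n k}}

  +-≤*n^ : ∀ {s t} C D k → s ≤ C * n ^ k → t ≤ D * n ^ k → s + t ≤ (C + D) * n ^ k
  +-≤*n^ C D k s≤ t≤ = ≤-trans (+-mono-≤ s≤ t≤) (≤-reflexive (sym (*-distribʳ-+ (n ^ k) C D)))

  *n^-⊔ˡ : ∀ {t} C k l → t ≤ C * n ^ k → t ≤ C * n ^ (k ⊔ l)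
  *n^-⊔ˡ C k l t≤ = ≤-trans t≤ (*-monoʳ-≤ C (^-monoʳ-≤ n (m≤m⊔n k l)))

  *n^-⊔ʳ : ∀ {t} C k l → t ≤ C * n ^ l → t ≤ C * n ^ (k ⊔ l)
  *n^-⊔ʳ C k l t≤ = ≤-trans t≤ (*-monoʳ-≤ C (^-monoʳ-≤ n (m≤n⊔m k l)))

  n*-≤*n^ : ∀ {t} C k → t ≤ C * n ^ k → n * t ≤ C * n ^ suc k
  n*-≤*n^ {t} C k t≤ = begin
    n * t             ≤⟨ *-monoʳ-≤ n t≤ ⟩
    n * (C * n ^ k)   ≡⟨ *-assoc n C (n ^ k) ⟨
    n * C * n ^ k     ≡⟨ cong (_* n ^ k) (*-comm n C) ⟩
    C * n * n ^ k     ≡⟨ *-assoc C n (n ^ k) ⟩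
    C * n ^ suc k     ∎
    where open ≤-Reasoning

-- This is the value of `time c 1`, that is, the sum of the coefficients of `time c n` as a
-- polynomial in `n`.
timeConstant : Command → ℕ
timeConstant skip                     = 1
timeConstant (r ≔ e)                  = suc (cost e)
timeConstant (mem[ a ]≔ e)            = suc (cost a + cost e)
timeConstant (c₁ ⨟ c₂)                = 1 + (timeConstant c₁ + timeConstant c₂)
timeConstant (ifNZ e then c₁ else c₂) = suc (cost e) + (timeConstant c₁ + timeConstant c₂)
timeConstant (whileNZ e loop c)       = suc (cost e) + (suc (cost e) + timeConstant c)

-- For `n ≥ 1` every lower power of `n` is at most the highest one, so the coefficients can simply
-- be added.
time≤ : ∀ c n .{{_ : NonZero n}} → time c n ≤ timeConstant c * n ^ loopDepth c
time≤ skip n          = const≤*n^ n 1 0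
time≤ (r ≔ e) n       = const≤*n^ n (suc (cost e)) 0
time≤ (mem[ a ]≔ e) n = const≤*n^ n (suc (cost a + cost e)) 0
time≤ (c₁ ⨟ c₂) n     =
  +-≤*n^ n 1 (timeConstant c₁ + timeConstant c₂) k (const≤*n^ n 1 k)
    (+-≤*n^ n (timeConstant c₁) (timeConstant c₂) k
      (*n^-⊔ˡ n (timeConstant c₁) (loopDepth c₁) (loopDepth c₂) (time≤ c₁ n))
      (*n^-⊔ʳ n (timeConstant c₂) (loopDepth c₁) (loopDepth c₂) (time≤ c₂ n)))
  where k = loopDepth c₁ ⊔ loopDepth c₂
time≤ (ifNZ e then c₁ else c₂) n =
  +-≤*n^ n (suc (cost e)) (timeConstant c₁ + timeConstant c₂) k (const≤*n^ n (suc (cost e)) k)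
    (+-≤*n^ n (timeConstant c₁) (timeConstant c₂) k
      (*n^-⊔ˡ n (timeConstant c₁) (loopDepth c₁) (loopDepth c₂) (time≤ c₁ n))
      (*n^-⊔ʳ n (timeConstant c₂) (loopDepth c₁) (loopDepth c₂) (time≤ c₂ n)))
  where k = loopDepth c₁ ⊔ loopDepth c₂
time≤ (whileNZ e loop c) n =
  +-≤*n^ n (suc (cost e)) (suc (cost e) + timeConstant c) (suc k) (const≤*n^ n (suc (cost e)) (suc k))
    (n*-≤*n^ n (suc (cost e) + timeConstant c) k
      (+-≤*n^ n (suc (cost e)) (timeConstant c) k (const≤*n^ n (suc (cost e)) k) (time≤ c n)))
  where k = loopDepth c

time∈O : ∀ c → time c ∈O (λ n → n ^ loopDepth c)
time∈O c = timeConstant c , 1 , λ { (suc n) _ → time≤ c (suc n) }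

-- Total correctness from a given state, with the step bound built in. As with weakest
-- preconditions, `Q` may itself be a run of the next command, which is how `run-⨟` chains commands.
record Runs (n : ℕ) (c : Command) (σ : State) (Q : State → Set) : Set where
  constructor runs
  field
    {final}    : State
    {steps}    : ℕ
    derivation : ⟨ c , σ ⟩⇓⟨ final , steps ⟩
    steps≤time : steps ≤ time c n
    holds      : Q final

module _ {n : ℕ} {σ : State} {Q : State → Set} where

  run-skip : Q σ → Runs n skip σ Q
  run-skip q = runs skip ≤-refl q

  run-≔ : ∀ {r e} → Q (state (regs σ [ r ↦ eval e σ ]) (memory σ)) → Runs n (r ≔ e) σ Q
  run-≔ q = runs assign ≤-refl q

  run-store : ∀ {a e} → Q (state (regs σ) (memory σ [ eval a σ ↦ eval e σ ])) →
              Runs n (mem[ a ]≔ e) σ Q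
  run-store q = runs store ≤-refl q

  run-⨟ : ∀ {c₁ c₂} → Runs n c₁ σ (λ σ′ → Runs n c₂ σ′ Q) → Runs n (c₁ ⨟ c₂) σ Q
  run-⨟ (runs D₁ t₁≤ (runs D₂ t₂≤ q)) = runs (seq D₁ D₂) (s≤s (+-mono-≤ t₁≤ t₂≤)) q

  run-if : ∀ {e c₁ c₂} → (eval e σ ≢ 0 → Runs n c₁ σ Q) → (eval e σ ≡ 0 → Runs n c₂ σ Q) →
           Runs n (ifNZ e then c₁ else c₂) σ Q
  run-if {e} yes-branch no-branch with eval e σ ≟ 0
  ... | no e≢0  = let runs D t≤ q = yes-branch e≢0 in
    runs (ifTrue e≢0 D) (s≤s (+-monoʳ-≤ (cost e) (≤-trans t≤ (m≤m+n _ _)))) q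
  ... | yes e≡0 = let runs D t≤ q = no-branch e≡0 in
    runs (ifFalse e≡0 D) (s≤s (+-monoʳ-≤ (cost e) (≤-trans t≤ (m≤n+m _ _)))) q

  run-⇒ : ∀ {c P} → (∀ {σ′} → P σ′ → Q σ′) → Runs n c σ P → Runs n c σ Q
  run-⇒ P⇒Q (runs D t≤ p) = runs D t≤ (P⇒Q p)

reindex : ∀ (I : ℕ → State → Set) {k l σ} → k ≡ l → I k σ → I l σ
reindex I refl Iσ = Iσ

-- `I m` is the invariant after `m` iterations. The guard evaluates to `n ∸ m`, which vanishes
-- exactly when `m` reaches `n`, so the body runs `n` times.
run-while : ∀ {n e c} (I : ℕ → State → Set) →
  (∀ m {σ} → I m σ → eval e σ ≡ n ∸ m) →
  (∀ (i : Fin n) {σ} → I (toℕ i) σ → Runs n c σ (I (suc (toℕ i)))) →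
  ∀ {σ} → I 0 σ → Runs n (whileNZ e loop c) σ (I n)
run-while {n} {e} {c} I guard step I₀ =
  let _ , _ , D , t≤ , Iₙ = iterate n 0 (+-identityʳ n) I₀ in runs D t≤ Iₙ
  where
  iterate : ∀ r m → r + m ≡ n → ∀ {σ} → I m σ → ∃₂ λ σ′ t →
    ⟨ whileNZ e loop c , σ ⟩⇓⟨ σ′ , t ⟩ ×
    t ≤ suc (cost e) + r * suc (cost e + time c n) × I n σ′
  iterate zero m refl Iσ =
    _ , _ , whileFalse (trans (guard n Iσ) (n∸n≡0 n)) , m≤m+n _ _ , Iσ
  iterate (suc r) m r+m≡n {σ} Iσ =
    let m<n                    = subst (m <_) r+m≡n (s≤s (m≤n+m m r))
        toℕ-i                  = Fin.toℕ-fromℕ< m<n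
        runs D₁ t₁≤ I′         = step (fromℕ< m<n) (reindex I (sym toℕ-i) Iσ)
        _ , _ , D₂ , t₂≤ , Iₙ  = iterate r (suc m) (trans (+-suc r m) r+m≡n)
                                   (reindex I (cong suc toℕ-i) I′)
    in _ , _ , whileTrue (λ e≡0 → m>n⇒m∸n≢0 m<n (trans (sym (guard m Iσ)) e≡0)) D₁ D₂ ,
       -- The cost of the final, failing test is moved to the front, which joins this iteration to
       -- the `r` remaining ones.
       ≤-trans (+-mono-≤ (s≤s (+-monoʳ-≤ (cost e) t₁≤)) t₂≤)
         (≤-reflexive (x∙yz≈y∙xz (suc (cost e + time c n)) (suc (cost e)) _)) ,
       Iₙ

-- Loops over the vertices and over the cells of the matrix.

order mid row col midBase rowBase count best : ℕ
order   = 0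
mid     = 1
row     = 2
col     = 3
midBase = 4
rowBase = 5
count   = 6
best    = 7

-- Truncated subtraction serves as the comparison: the guard is nonzero exactly while register `r`
-- is below `order`.
upTo-order : ℕ → Command → Command
upTo-order r c = whileNZ (reg order ⊖ reg r) loop c

-- The machine has no multiplication, so `rowBase` follows `row * n` by repeated addition. The
-- operands are ordered so that the new values unfold to `suc` and to `suc i * n`.
forCells : Command → Command
forCells c =
  row ≔ lit 0 ⨟
  rowBase ≔ lit 0 ⨟
  upTo-order row (
    col ≔ lit 0 ⨟
    upTo-order col (
      c ⨟
      col ≔ lit 1 ⊕ reg col) ⨟
    row ≔ lit 1 ⊕ reg row ⨟
    rowBase ≔ reg order ⊕ reg rowBase)

forMid : Command → Command
forMid c =
  mid ≔ lit 0 ⨟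
  midBase ≔ lit 0 ⨟
  upTo-order mid (
    c ⨟
    mid ≔ lit 1 ⊕ reg mid ⨟
    midBase ≔ reg order ⊕ reg midBase)

AtCell : ℕ → ℕ → ℕ → State → Set
AtCell n i j σ =
  regs σ order ≡ n × regs σ row ≡ i × regs σ col ≡ j × regs σ rowBase ≡ i * n

AtMid : ℕ → ℕ → State → Set
AtMid n k σ = regs σ order ≡ n × regs σ mid ≡ k × regs σ midBase ≡ k * n

infix 4 _IgnoredBy_

-- Loop invariants are arbitrary predicates on states, so the loop rules must be told that updating
-- a loop register preserves them. For the invariants used below this holds by computation.
_IgnoredBy_ : ℕ → (State → Set) → Set
r IgnoredBy P = ∀ {f M} v → P (state f M) → P (state (f [ r ↦ v ]) M)

address : Fin n → Fin n → ℕ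
address {n} i j = toℕ i * n + toℕ j

run-forCells : ∀ {c} (I : ℕ → State → Set) →
  (∀ a → row IgnoredBy I a × col IgnoredBy I a × rowBase IgnoredBy I a) →
  (∀ (i j : Fin n) {σ} → AtCell n (toℕ i) (toℕ j) σ → I (address i j) σ →
     Runs n c σ λ σ′ → AtCell n (toℕ i) (toℕ j) σ′ × I (suc (address i j)) σ′) →
  ∀ {σ} → regs σ order ≡ n → I 0 σ →
  Runs n (forCells c) σ λ σ′ → regs σ′ order ≡ n × I (n * n) σ′
run-forCells {n} {c} I ignored step order≡n I₀ =
  run-⨟ (run-≔ (run-⨟ (run-≔ (run-⇒ (λ { ((o , _) , Iσ) → o , Iσ })
    (run-while AtRow (λ { m ((o , r , _) , _) → cong₂ _∸_ o r }) rowStep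
      ((order≡n , refl , refl) , ignore-rowBase _ 0 (ignore-row _ 0 I₀)))))))
  where
  ignore-row : ∀ a → row IgnoredBy I a
  ignore-row a = proj₁ (ignored a)
  ignore-col : ∀ a → col IgnoredBy I a
  ignore-col a = proj₁ (proj₂ (ignored a))
  ignore-rowBase : ∀ a → rowBase IgnoredBy I a
  ignore-rowBase a = proj₂ (proj₂ (ignored a))

  AtRow : ℕ → State → Set
  AtRow i σ = (regs σ order ≡ n × regs σ row ≡ i × regs σ rowBase ≡ i * n) × I (i * n) σ

  InRow : ℕ → ℕ → State → Set
  InRow i j σ = AtCell n i j σ × I (i * n + j) σ

  colStep : ∀ (i j : Fin n) {σ} → InRow (toℕ i) (toℕ j) σ →
            Runs n (c ⨟ col ≔ lit 1 ⊕ reg col) σ (InRow (toℕ i) (suc (toℕ j)))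
  colStep i j (at , Iσ) = run-⨟ (run-⇒
    (λ { ((o , r , cl , b) , I′) → run-≔ ((o , r , cong suc cl , b) ,
      ignore-col _ _ (reindex I (sym (+-suc (toℕ i * n) (toℕ j))) I′)) })
    (step i j at Iσ))

  rowStep : ∀ (i : Fin n) {σ} → AtRow (toℕ i) σ → Runs n _ σ (AtRow (suc (toℕ i)))
  rowStep i ((o , r , b) , Iσ) = run-⨟ (run-≔ (run-⨟ (run-⇒
    (λ { ((o′ , r′ , _ , b′) , I′) → run-⨟ (run-≔ (run-≔
      ((o′ , cong suc r′ , cong₂ _+_ o′ b′) ,
       ignore-rowBase _ _ (ignore-row _ _
         (reindex I (+-comm (toℕ i * n) n) I′))))) })
    (run-while (InRow (toℕ i)) (λ { m ((o′ , _ , cl , _) , _) → cong₂ _∸_ o′ cl }) (colStep i)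
      ((o , r , refl , b) ,
       ignore-col _ _ (reindex I (sym (+-identityʳ (toℕ i * n))) Iσ))))))

run-forMid : ∀ {c} (J : ℕ → State → Set) →
  (∀ k → mid IgnoredBy J k × midBase IgnoredBy J k) →
  (∀ (v : Fin n) {σ} → AtMid n (toℕ v) σ → J (toℕ v) σ →
     Runs n c σ λ σ′ → AtMid n (toℕ v) σ′ × J (suc (toℕ v)) σ′) →
  ∀ {σ} → regs σ order ≡ n → J 0 σ →
  Runs n (forMid c) σ λ σ′ → regs σ′ order ≡ n × J n σ′
run-forMid {n} {c} J ignored step order≡n J₀ =
  run-⨟ (run-≔ (run-⨟ (run-≔ (run-⇒ (λ { ((o , _) , Jσ) → o , Jσ })
    (run-while (λ k σ → AtMid n k σ × J k σ) (λ { m ((o , k , _) , _) → cong₂ _∸_ o k })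
      (λ { v (at , Jσ) → run-⨟ (run-⇒
        (λ { ((o , k , b) , J′) → run-⨟ (run-≔ (run-≔
          ((o , cong suc k , cong₂ _+_ o b) , advance _ J′))) })
        (step v at Jσ)) })
      ((order≡n , refl , refl) , advance 0 J₀))))))
  where
  advance : ∀ k {f M x y} → J k (state f M) → J k (state ((f [ mid ↦ x ]) [ midBase ↦ y ]) M)
  advance k Jσ = proj₂ (ignored k) _ (proj₁ (ignored k) _ Jσ)

-- Floyd–Warshall on the input matrix

address≡combine : ∀ (i j : Fin n) → address i j ≡ toℕ (combine i j)
address≡combine {n} i j =
  sym (trans (Fin.toℕ-combine i j) (cong (_+ toℕ j) (*-comm n (toℕ i))))

address< : ∀ (i j : Fin n) → address i j < n * n
address< {n} i j = subst (_< n * n) (sym (address≡combine i j)) (Fin.toℕ<n (combine i j))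

address-injective : ∀ (i j k l : Fin n) → address i j ≡ address k l → i ≡ k × j ≡ l
address-injective i j k l eq = Fin.combine-injective i j k l
  (Fin.toℕ-injective (trans (sym (address≡combine i j)) (trans eq (address≡combine k l))))

[↦]-same : ∀ f a v → (f [ a ↦ v ]) a ≡ v
[↦]-same f a v rewrite dec-true (a ≟ a) refl = refl

[↦]-other : ∀ f {a b} v → b ≢ a → (f [ a ↦ v ]) b ≡ f b
[↦]-other f {a} {b} v b≢a rewrite dec-false (b ≟ a) b≢a = refl

-- Passes that update the matrix in place.

CellPredicate : ℕ → Set₁
CellPredicate n = Fin n → Fin n → ℕ → Set

record Cells (P : CellPredicate n) (M : ℕ → ℕ) : Set where
  constructor cells
  field read : ∀ i j → P i j (M (address i j))

Entries : (Fin n → Fin n → ℕ) → CellPredicate n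
Entries D i j v = v ≡ D i j

-- During an in-place pass the memory mixes new cells, before `a`, with old ones, from `a` on.
record Progress (P Q : CellPredicate n) (a : ℕ) (M : ℕ → ℕ) : Set where
  constructor progress
  field
    done : ∀ i j → address i j < a → Q i j (M (address i j))
    todo : ∀ i j → a ≤ address i j → P i j (M (address i j))

module _ {P Q : CellPredicate n} where

  progress-start : ∀ {M} → Cells P M → Progress P Q 0 M
  progress-start (cells read) = progress (λ _ _ ()) λ i j _ → read i j

  progress-end : ∀ {M} → Progress P Q (n * n) M → Cells Q M
  progress-end (progress done _) = cells λ i j → done i j (address< i j)

  progress-next : ∀ {M} i j → Progress P Q (address i j) M → P i j (M (address i j))
  progress-next i j (progress _ todo) = todo i j ≤-refl

  progress-step : ∀ {M M′} i j → Q i j (M′ (address i j)) →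
    (∀ b → b ≢ address i j → M′ b ≡ M b) →
    Progress P Q (address i j) M → Progress P Q (suc (address i j)) M′
  progress-step {M} {M′} i j Qij same (progress done todo) =
    progress done′ λ k l a< → subst (P k l) (sym (same _ (>⇒≢ a<))) (todo k l (<⇒≤ a<))
    where
    done′ : ∀ k l → address k l < suc (address i j) → Q k l (M′ (address k l))
    done′ k l (s≤s kl≤ij) with address k l ≟ address i j
    ... | yes eq with refl , refl ← address-injective k l i j eq = Qij
    ... | no  ≢  = subst (Q k l) (sym (same _ ≢)) (done k l (≤∧≢⇒< kl≤ij ≢))

  progress-keep : ∀ {M} i j → Q i j (M (address i j)) →
    Progress P Q (address i j) M → Progress P Q (suc (address i j)) M
  progress-keep i j Qij = progress-step i j Qij λ _ _ → refl

  progress-write : ∀ {M} i j {a v} → a ≡ address i j → Q i j v →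
    Progress P Q (address i j) M → Progress P Q (suc (address i j)) (M [ a ↦ v ])
  progress-write {M} i j {v = v} refl Qij = progress-step i j
    (subst (Q i j) (sym ([↦]-same M (address i j) v)) Qij) λ _ → [↦]-other M v

  -- For reading a cell without knowing whether the pass has already overwritten it.
  progress-either : ∀ {M a} {R : ℕ → Set} i j → (∀ {v} → P i j v → R v) → (∀ {v} → Q i j v → R v) →
    Progress P Q a M → R (M (address i j))
  progress-either {a = a} i j P⇒R Q⇒R (progress done todo) with address i j <? a
  ... | yes <a = Q⇒R (done i j <a)
  ... | no  ≮a = P⇒R (todo i j (≮⇒≥ ≮a))

-- Minimum and absolute difference by truncated subtraction.

m∸[m∸n]≡m⊓n : ∀ m n → m ∸ (m ∸ n) ≡ m ⊓ n
m∸[m∸n]≡m⊓n m n with ≤-total n m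
... | inj₁ n≤m = trans (m∸[m∸n]≡n n≤m) (sym (m≥n⇒m⊓n≡n n≤m))
... | inj₂ m≤n = trans (cong (m ∸_) (m≤n⇒m∸n≡0 m≤n)) (sym (m≤n⇒m⊓n≡m m≤n))

gap : ℕ → ℕ → ℕ
gap m n = (m ∸ n) + (n ∸ m)

gap-refl : ∀ m → gap m m ≡ 0
gap-refl m = cong₂ _+_ (n∸n≡0 m) (n∸n≡0 m)

gap≡0⇒≡ : ∀ m n → gap m n ≡ 0 → m ≡ n
gap≡0⇒≡ m n eq = ≤-antisym (m∸n≡0⇒m≤n (m+n≡0⇒m≡0 (m ∸ n) eq))
                           (m∸n≡0⇒m≤n (m+n≡0⇒n≡0 (m ∸ n) eq))

-- Relaxation and the stages of Floyd-Warshall.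

relax : Fin n → (Fin n → Fin n → ℕ) → Fin n → Fin n → ℕ
relax v D i j = D i j ⊓ (D i v + D v j)

-- A detour through `v` on the way to `v` adds `D v v ≥ 0` and so never helps.
relax-col : ∀ (v : Fin n) D i → relax v D i v ≡ D i v
relax-col v D i = m≤n⇒m⊓n≡m (m≤m+n (D i v) (D v v))

relax-row : ∀ (v : Fin n) D j → relax v D v j ≡ D v j
relax-row v D j = m≤n⇒m⊓n≡m (m≤n+m (D v j) (D v v))

≤-⊓+⊓ : ∀ {x} a b c e → x ≤ a + c → x ≤ a + e → x ≤ b + c → x ≤ b + e → x ≤ (a ⊓ b) + (c ⊓ e)
≤-⊓+⊓ a b c e ac ae bc be with ⊓-sel a b | ⊓-sel c e
... | inj₁ p | inj₁ q rewrite p | q = ac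
... | inj₁ p | inj₂ q rewrite p | q = ae
... | inj₂ p | inj₁ q rewrite p | q = bc
... | inj₂ p | inj₂ q rewrite p | q = be

module _ (G : Graph n) where
  open Graph G

  -- For `k = n` the last three fields are the hypotheses of `d-greatest` and give
  -- `D i j ≤ d G i j`, the converse of `d≤D`.
  record Stage (k : ℕ) (D : Fin n → Fin n → ℕ) : Set where
    field
      d≤D        : ∀ i j → d G i j ≤ D i j
      D-refl     : ∀ i → D i i ≤ 0
      D-adj      : ∀ {i j} → Adj i j → D i j ≤ 1
      D-triangle : ∀ v → toℕ v < k → ∀ i j → D i j ≤ D i v + D v j

  relax-stage : ∀ v {D} → Stage (toℕ v) D → Stage (suc (toℕ v)) (relax v D)
  relax-stage v {D} stage = record
    { d≤D        = λ i j → ⊓-glb (d≤D i j)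
                     (≤-trans (d-triangle G i v j) (+-mono-≤ (d≤D i v) (d≤D v j)))
    ; D-refl     = λ i → ≤-trans (m⊓n≤m _ _) (D-refl i)
    ; D-adj      = λ ij → ≤-trans (m⊓n≤m _ _) (D-adj ij)
    ; D-triangle = triangle
    }
    where
    open Stage stage

    old : ∀ u → toℕ u < toℕ v → ∀ i j → relax v D i j ≤ relax v D i u + relax v D u j
    -- Each of the legs `i` to `u` and `u` to `j` is either old or passes through `v`, which gives
    -- four cases. When both pass through `v`, the excursion from `v` to `u` and back is dropped.
    old u u<v i j = ≤-⊓+⊓ (D i u) (D i v + D v u) (D u j) (D u v + D v j)
      (≤-trans (m⊓n≤m _ _) (D-triangle u u<v i j))
      (≤-trans through-v (≤-trans (+-monoˡ-≤ (D v j) (D-triangle u u<v i v))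
        (≤-reflexive (+-assoc (D i u) (D u v) (D v j)))))
      (≤-trans through-v (≤-trans (+-monoʳ-≤ (D i v) (D-triangle u u<v v j))
        (≤-reflexive (sym (+-assoc (D i v) (D v u) (D u j))))))
      (≤-trans through-v (+-mono-≤ (m≤m+n (D i v) (D v u)) (m≤n+m (D v j) (D u v))))
      where
      through-v : relax v D i j ≤ D i v + D v j
      through-v = m⊓n≤n _ _

    triangle : ∀ u → toℕ u < suc (toℕ v) → ∀ i j → relax v D i j ≤ relax v D i u + relax v D u j
    triangle u (s≤s u≤v) i j with u Fin.≟ v
    -- Row and column `v` are unchanged, so the inequality at `v` is the second argument of the
    -- minimum.
    ... | yes refl = ≤-trans (m⊓n≤n (D i j) _)
      (≤-reflexive (sym (cong₂ _+_ (relax-col v D i) (relax-row v D j))))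
    ... | no u≢v = old u (≤∧≢⇒< u≤v (u≢v ∘ Fin.toℕ-injective)) i j

  stage-n : ∀ {D} → Stage n D → ∀ i j → D i j ≡ d G i j
  stage-n stage i j = ≤-antisym
    (d-greatest G _ D-refl D-adj (λ x z y → D-triangle z (Fin.toℕ<n z) x y) i j) (d≤D i j)
    where open Stage stage

  adjacency : Fin n → Fin n → ℕ
  adjacency i j = if adj i j then 1 else 0

  adjacencyMemory-address : ∀ i j → adjacencyMemory G (address i j) ≡ adjacency i j
  adjacencyMemory-address i j rewrite address≡combine i j with toℕ (combine i j) <? n * n
  ... | yes a<n² = cong (λ ij → if uncurry adj ij then 1 else 0)
    (trans (cong (remQuot n) (Fin.fromℕ<-toℕ (combine i j) a<n²)) (Fin.remQuot-combine i j))
  ... | no  a≮n² = contradiction (Fin.toℕ<n (combine i j)) a≮n²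

-- The size of a subset as accumulated by a loop.

prefixSize : Subset n → ℕ → ℕ
prefixSize []            m       = 0
prefixSize (_ ∷ p)       zero    = 0
prefixSize (inside ∷ p)  (suc m) = suc (prefixSize p m)
prefixSize (outside ∷ p) (suc m) = prefixSize p m

sideSize : Side → ℕ
sideSize inside  = 1
sideSize outside = 0

prefixSize-n : (p : Subset n) → prefixSize p n ≡ ∣ p ∣
prefixSize-n []            = refl
prefixSize-n (inside ∷ p)  = cong suc (prefixSize-n p)
prefixSize-n (outside ∷ p) = prefixSize-n p

prefixSize-0 : (p : Subset n) → prefixSize p 0 ≡ 0
prefixSize-0 []      = refl
prefixSize-0 (_ ∷ _) = refl

prefixSize-suc : (p : Subset n) → ∀ i →
  prefixSize p (suc (toℕ i)) ≡ prefixSize p (toℕ i) + sideSize (lookup p i)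
prefixSize-suc (inside ∷ p)  zero    = cong suc (prefixSize-0 p)
prefixSize-suc (outside ∷ p) zero    = prefixSize-0 p
prefixSize-suc (inside ∷ p)  (suc i) = cong suc (prefixSize-suc p i)
prefixSize-suc (outside ∷ p) (suc i) = prefixSize-suc p i

-- `1 ∸ (1 ∸ g)` is the sign of `g`: 0 for zero and 1 otherwise.
sign-gap : ∀ a b (a≟b : Dec (a ≡ b)) → 1 ∸ (1 ∸ gap a b) ≡ sideSize (does (¬? a≟b))
sign-gap a b (yes refl) rewrite gap-refl a = refl
sign-gap a b (no a≢b) with gap a b | gap≡0⇒≡ a b
... | zero  | gap⇒≡ = contradiction (gap⇒≡ refl) a≢b
... | suc g | _     = cong (1 ∸_) (0∸n≡0 g)

-- The program.

differ : Expr → Expr → Expr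
differ e₁ e₂ = (e₁ ⊖ e₂) ⊕ (e₂ ⊖ e₁)

lower : Expr → Expr → Expr
lower e₁ e₂ = e₁ ⊖ (e₁ ⊖ e₂)

cell : Expr
cell = mem (reg rowBase ⊕ reg col)

-- n is a proxy for infinity: all distances are less than n.
initialiseCell : Command
initialiseCell =
  ifNZ cell
    then skip
    else ifNZ differ (reg row) (reg col)
      then mem[ reg rowBase ⊕ reg col ]≔ reg order
      else skip

relaxCell : Command
relaxCell =
  mem[ reg rowBase ⊕ reg col ]≔
    lower cell (mem (reg rowBase ⊕ reg mid) ⊕ mem (reg midBase ⊕ reg col))

-- Here `mid` is the vertex `z` tested for membership in `𝓓` of `row` and `col`; the double
-- subtraction from 1 turns any nonzero difference into a single count.
countDistinguished : Command
countDistinguished =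
  count ≔ reg count ⊕
    (lit 1 ⊖ (lit 1 ⊖ differ (mem (reg midBase ⊕ reg row)) (mem (reg midBase ⊕ reg col))))

minimiseCell : Command
minimiseCell =
  ifNZ differ (reg row) (reg col)
    then
      count ≔ lit 0 ⨟
      forMid countDistinguished ⨟
      best ≔ lower (reg best) (reg count)
    else skip

𝔡-program : Command
𝔡-program =
  forCells initialiseCell ⨟
  forMid (forCells relaxCell) ⨟
  -- The order is a safe starting value, since `𝔡 G ≤ n`.
  best ≔ reg order ⨟
  forCells minimiseCell ⨟
  order ≔ reg best

-- Correctness of the program.

module _ (G : Graph n) where
  open Graph G

  -- What `Stage G 0` asks of a single cell; the proxy `n` meets it at nonadjacent pairs off the
  -- diagonal.
  IsEdgeLength : CellPredicate n
  IsEdgeLength i j v = d G i j ≤ v × (i ≡ j → v ≤ 0) × (Adj i j → v ≤ 1)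

  run-initialise : ∀ {σ} → regs σ order ≡ n → Cells (Entries (adjacency G)) (memory σ) →
    Runs n (forCells initialiseCell) σ λ σ′ →
      regs σ′ order ≡ n × Cells IsEdgeLength (memory σ′)
  run-initialise o adjacencies = run-⇒ (λ { (o′ , π) → o′ , progress-end π })
    (run-forCells I (λ _ → (λ _ → id) , (λ _ → id) , (λ _ → id)) step o
      (progress-start adjacencies))
    where
    I : ℕ → State → Set
    I a σ = Progress (Entries (adjacency G)) IsEdgeLength a (memory σ)

    adjacent : ∀ i j {v} → v ≡ adjacency G i j → v ≢ 0 → IsEdgeLength i j v
    adjacent i j v≡ v≢0 with adj i j in eq
    ... | false = contradiction v≡ v≢0
    ... | true rewrite v≡ =
      Adj⇒d≤1 G (subst T (sym eq) _) ,
      (λ { refl → contradiction (trans (sym eq) (irreflexive i)) λ () }) , λ _ → ≤-refl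

    diagonal : ∀ i {v} → v ≡ 0 → IsEdgeLength i i v
    diagonal i refl = ≤-reflexive (d-refl G i) , (λ _ → z≤n) , λ _ → z≤n

    distant : ∀ i j {v} → i ≢ j → v ≡ adjacency G i j → v ≡ 0 → IsEdgeLength i j n
    distant i j i≢j v≡ v≡0 =
      <⇒≤ (d<n G i j) , (λ i≡j → contradiction i≡j i≢j) , not-adjacent
      where
      not-adjacent : Adj i j → n ≤ 1
      not-adjacent _ with adj i j
      not-adjacent _  | true with () ← trans (sym v≡) v≡0

    step : ∀ (i j : Fin n) {σ} → AtCell n (toℕ i) (toℕ j) σ → I (address i j) σ →
           Runs n initialiseCell σ λ σ′ → AtCell n (toℕ i) (toℕ j) σ′ × I (suc (address i j)) σ′
    step i j {σ} at@(o , r , c , b) π =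
      run-if
        (λ v≢0 → run-skip (at , progress-keep i j
          (adjacent i j unset (v≢0 ∘ trans (cong (memory σ) here-address))) π))
        (λ v≡0 → run-if
          (λ i≢j → run-store (at , progress-write i j here-address
            (subst (IsEdgeLength i j) (sym o) (distant i j (≢-from-gap i≢j) unset
              (trans (cong (memory σ) (sym here-address)) v≡0))) π))
          (λ i≡j → run-skip (at , progress-keep i j
            (on-diagonal (Fin.toℕ-injective (gap≡0⇒≡ _ _ (trans (sym (cong₂ gap r c)) i≡j)))
              (trans (cong (memory σ) (sym here-address)) v≡0)) π)))
      where
      here-address : regs σ rowBase + regs σ col ≡ address i j
      here-address = cong₂ _+_ b c

      unset : memory σ (address i j) ≡ adjacency G i j
      unset = progress-next i j π

      ≢-from-gap : gap (regs σ row) (regs σ col) ≢ 0 → i ≢ j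
      ≢-from-gap gap≢0 refl = gap≢0 (trans (cong₂ gap r c) (gap-refl (toℕ i)))

      on-diagonal : ∀ {v} → i ≡ j → v ≡ 0 → IsEdgeLength i j v
      on-diagonal refl = diagonal i

  run-relaxCells : ∀ v {D σ} → AtMid n (toℕ v) σ → Cells (Entries D) (memory σ) →
    Runs n (forCells relaxCell) σ λ σ′ →
      AtMid n (toℕ v) σ′ × Cells (Entries (relax v D)) (memory σ′)
  run-relaxCells v {D} (o , k , kb) entries =
    run-⇒ (λ { (o′ , k′ , kb′ , π) → (o′ , k′ , kb′) , progress-end π })
      (run-forCells I (λ _ → (λ _ → id) , (λ _ → id) , (λ _ → id)) step o
        (k , kb , progress-start entries))
    where
    I : ℕ → State → Set
    I a σ = regs σ mid ≡ toℕ v × regs σ midBase ≡ toℕ v * n ×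
            Progress (Entries D) (Entries (relax v D)) a (memory σ)

    step : ∀ (i j : Fin n) {σ} → AtCell n (toℕ i) (toℕ j) σ → I (address i j) σ →
           Runs n relaxCell σ λ σ′ → AtCell n (toℕ i) (toℕ j) σ′ × I (suc (address i j)) σ′
    step i j {σ} at@(o , r , c , b) (k , kb , π) =
      run-store (at , k , kb , progress-write i j (cong₂ _+_ b c) value π)
      where
      M = memory σ

      -- Relaxing through v leaves row and column v unchanged, so it does not
      -- matter whether these entries have been overwritten already.
      to-v : M (address i v) ≡ D i v
      to-v = progress-either {R = _≡ D i v} i v id (λ eq → trans eq (relax-col v D i)) π

      from-v : M (address v j) ≡ D v j
      from-v = progress-either {R = _≡ D v j} v j id (λ eq → trans eq (relax-row v D j)) π

      current : M (regs σ rowBase + regs σ col) ≡ D i j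
      current = trans (cong M (cong₂ _+_ b c)) (progress-next i j π)

      through-v : M (regs σ rowBase + regs σ mid) + M (regs σ midBase + regs σ col) ≡ D i v + D v j
      through-v = cong₂ _+_ (trans (cong M (cong₂ _+_ b k)) to-v)
                            (trans (cong M (cong₂ _+_ kb c)) from-v)

      value : eval (lower cell (mem (reg rowBase ⊕ reg mid) ⊕ mem (reg midBase ⊕ reg col))) σ ≡
              relax v D i j
      value = trans (m∸[m∸n]≡m⊓n _ _) (cong₂ _⊓_ current through-v)

  run-distances : ∀ {σ} → regs σ order ≡ n → Cells IsEdgeLength (memory σ) →
    Runs n (forMid (forCells relaxCell)) σ λ σ′ →
      regs σ′ order ≡ n × Cells (Entries (d G)) (memory σ′)
  run-distances {σ} o (cells edges) =
    run-⇒ (λ { (o′ , D , stage , cells entries) →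
             o′ , cells λ i j → trans (entries i j) (stage-n G stage i j) })
      (run-forMid I (λ _ → (λ _ → id) , (λ _ → id))
        (λ { v at (D , stage , entries) → run-⇒
          (λ { (at′ , entries′) → at′ , relax v D , relax-stage G v stage , entries′ })
          (run-relaxCells v at entries) })
        o ((λ i j → memory σ (address i j)) , stage₀ , cells λ _ _ → refl))
    where
    I : ℕ → State → Set
    -- The invariant leaves the current matrix unnamed and records only that it has reached stage
    -- `k`.
    I k σ = ∃ λ D → Stage G k D × Cells (Entries D) (memory σ)

    stage₀ : Stage G 0 (λ i j → memory σ (address i j))
    stage₀ = record
      { d≤D        = λ i j → proj₁ (edges i j)
      ; D-refl     = λ i → proj₁ (proj₂ (edges i i)) refl
      ; D-adj      = λ {i} {j} → proj₂ (proj₂ (edges i j))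
      ; D-triangle = λ _ ()
      }

  -- The value `b` is squeezed between `𝔡 G` and the sizes for the pairs visited so far. Once all
  -- pairs are visited, one that attains `𝔡 G` forces equality.
  LeastBelow : ℕ → ℕ → Set
  LeastBelow a b = 𝔡 G ≤ b × (∀ x y → x ≢ y → address x y < a → b ≤ ∣ 𝓓 G x y ∣)

  leastBelow-skip : ∀ (i : Fin n) {b} → LeastBelow (address i i) b → LeastBelow (suc (address i i)) b
  leastBelow-skip i {b} (𝔡≤b , b≤) = 𝔡≤b , b≤′
    where
    b≤′ : ∀ x y → x ≢ y → address x y < suc (address i i) → b ≤ ∣ 𝓓 G x y ∣
    b≤′ x y x≢y (s≤s xy≤) = b≤ x y x≢y (≤∧≢⇒< xy≤ λ eq →
      let x≡i , y≡i = address-injective x y i i eq in x≢y (trans x≡i (sym y≡i)))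

  leastBelow-step : ∀ (i j : Fin n) {b} → i ≢ j → LeastBelow (address i j) b →
                    LeastBelow (suc (address i j)) (b ⊓ ∣ 𝓓 G i j ∣)
  leastBelow-step i j {b} i≢j (𝔡≤b , b≤) = ⊓-glb 𝔡≤b (𝔡≤∣𝓓∣ G i≢j) , b≤′
    where
    b≤′ : ∀ x y → x ≢ y → address x y < suc (address i j) → b ⊓ ∣ 𝓓 G i j ∣ ≤ ∣ 𝓓 G x y ∣
    b≤′ x y x≢y (s≤s xy≤) with address x y ≟ address i j
    ... | yes eq with refl , refl ← address-injective x y i j eq = m⊓n≤n b _
    ... | no  ≢  = ≤-trans (m⊓n≤m b _) (b≤ x y x≢y (≤∧≢⇒< xy≤ ≢))

  leastBelow-end : ∀ {b} → LeastBelow (n * n) b → b ≡ 𝔡 G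
  leastBelow-end {b} (𝔡≤b , b≤) =
    let (x , y , x≢y , ∣𝓓∣≡𝔡) , _ = 𝔡-isMinimum G in
    ≤-antisym (subst (b ≤_) ∣𝓓∣≡𝔡 (b≤ x y x≢y (address< x y))) 𝔡≤b

  𝔡≤n : 𝔡 G ≤ n
  𝔡≤n = let (x , y , _ , ∣𝓓∣≡𝔡) , _ = 𝔡-isMinimum G in
    subst (_≤ n) ∣𝓓∣≡𝔡 (∣p∣≤n (𝓓 G x y))

  prefixSize-𝓓 : ∀ z x y →
    prefixSize (𝓓 G x y) (toℕ z) + (1 ∸ (1 ∸ gap (d G z x) (d G z y))) ≡
    prefixSize (𝓓 G x y) (suc (toℕ z))
  prefixSize-𝓓 z x y = sym (trans (prefixSize-suc (𝓓 G x y) z) (cong (prefixSize (𝓓 G x y) (toℕ z) +_)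
    (trans (cong sideSize (lookup∘tabulate (does ∘ differs?) z))
           (sym (sign-gap (d G z x) (d G z y) (d G z x ≟ d G z y))))))
    where
    differs? = λ z → ¬? (d G z x ≟ d G z y)

  -- The loop writes only `mid`, `midBase` and `count`, so the facts needed by the enclosing pass
  -- are carried along in its invariant.
  run-count : ∀ i j a {σ} → AtCell n (toℕ i) (toℕ j) σ → regs σ count ≡ 0 →
    Cells (Entries (d G)) (memory σ) → LeastBelow a (regs σ best) →
    Runs n (forMid countDistinguished) σ λ σ′ →
      AtCell n (toℕ i) (toℕ j) σ′ × Cells (Entries (d G)) (memory σ′) ×
      LeastBelow a (regs σ′ best) × regs σ′ count ≡ ∣ 𝓓 G i j ∣
  run-count i j a at@(o , _) count≡0 entries least =
    run-⇒ (λ { (_ , at′ , entries′ , least′ , c) →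
             at′ , entries′ , least′ , trans c (prefixSize-n (𝓓 G i j)) })
      (run-forMid I (λ _ → (λ _ → id) , (λ _ → id)) step o
        (at , entries , least , trans count≡0 (sym (prefixSize-0 (𝓓 G i j)))))
    where
    I : ℕ → State → Set
    I k σ = AtCell n (toℕ i) (toℕ j) σ × Cells (Entries (d G)) (memory σ) ×
            LeastBelow a (regs σ best) × regs σ count ≡ prefixSize (𝓓 G i j) k

    step : ∀ v {σ} → AtMid n (toℕ v) σ → I (toℕ v) σ →
           Runs n countDistinguished σ λ σ′ → AtMid n (toℕ v) σ′ × I (suc (toℕ v)) σ′
    step v {σ} atMid@(_ , _ , kb) (at@(_ , r , c , _) , entries@(cells read) , least , size) =
      run-≔ (atMid , at , entries , least , trans
        (cong₂ (λ s g → s + (1 ∸ (1 ∸ g))) size (cong₂ gap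
          (trans (cong (memory σ) (cong₂ _+_ kb r)) (read v i))
          (trans (cong (memory σ) (cong₂ _+_ kb c)) (read v j))))
        (prefixSize-𝓓 v i j))

  run-minimise : ∀ {σ} → regs σ order ≡ n → regs σ best ≡ n →
    Cells (Entries (d G)) (memory σ) →
    Runs n (forCells minimiseCell) σ λ σ′ → regs σ′ best ≡ 𝔡 G
  run-minimise o best≡n entries =
    run-⇒ (λ { (_ , _ , least) → leastBelow-end least })
      (run-forCells I (λ _ → (λ _ → id) , (λ _ → id) , (λ _ → id)) step o
        (entries , subst (𝔡 G ≤_) (sym best≡n) 𝔡≤n , λ _ _ _ ()))
    where
    I : ℕ → State → Set
    I a σ = Cells (Entries (d G)) (memory σ) × LeastBelow a (regs σ best)

    step : ∀ (i j : Fin n) {σ} → AtCell n (toℕ i) (toℕ j) σ → I (address i j) σ →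
           Runs n minimiseCell σ λ σ′ → AtCell n (toℕ i) (toℕ j) σ′ × I (suc (address i j)) σ′
    step i j {σ} at@(_ , r , c , _) (entries , least) = run-if
      (λ gap≢0 → run-⨟ (run-≔ (run-⨟ (run-⇒
        (λ { (at′ , entries′ , least′ , size) → run-≔ (at′ , entries′ ,
          subst (LeastBelow (suc (address i j)))
            (sym (trans (m∸[m∸n]≡m⊓n _ _) (cong (_ ⊓_) size)))
            (leastBelow-step i j (distinct gap≢0) least′)) })
        (run-count i j (address i j) at refl entries least)))))
      (λ gap≡0 → run-skip (at , entries , skip-diagonal
        (Fin.toℕ-injective (gap≡0⇒≡ _ _ (trans (sym (cong₂ gap r c)) gap≡0))) least))
      where
      distinct : gap (regs σ row) (regs σ col) ≢ 0 → i ≢ j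
      distinct gap≢0 refl = gap≢0 (trans (cong₂ gap r c) (gap-refl (toℕ i)))

      skip-diagonal : ∀ {b} → i ≡ j → LeastBelow (address i j) b → LeastBelow (suc (address i j)) b
      skip-diagonal refl = leastBelow-skip i

  run-𝔡-program : Runs n 𝔡-program (input G) λ σ → output σ ≡ 𝔡 G
  run-𝔡-program =
    run-⨟ (run-⇒ (λ { (o , edges) →
    run-⨟ (run-⇒ (λ { (o , entries) →
    run-⨟ (run-≔ (
    run-⨟ (run-⇒ run-≔
      -- After `best ≔ reg order` both registers hold the same value, so one proof serves for both.
      (run-minimise o o entries)))) })
      (run-distances o edges)) })
      (run-initialise refl (cells (adjacencyMemory-address G))))

𝔡-timeComplexity : HasTimeComplexityO 𝔡 (λ n → n ^ 3)
𝔡-timeComplexity = 𝔡-program , time 𝔡-program ,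
  (λ G → let runs D t≤ out = run-𝔡-program G in _ , _ , D , out , t≤) ,
  -- `loopDepth 𝔡-program` evaluates to 3: relaxation nests the cell loops in a vertex loop, and
  -- minimisation nests a vertex loop in the cell loops.
  time∈O 𝔡-program

theorem3 : (∀ {n : ℕ} (G : Graph n) → IsPartitionDimensional G (𝔡 G)) ×
    HasTimeComplexityO 𝔡 (λ n → n ^ 3)
theorem3 = 𝔡-partitionDimensional , 𝔡-timeComplexity
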